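{- Let $\mathcal{S}\subseteq 2^{[n]}$ be a nonempty Sperner family with $|\mathcal{S}|\le 4$, let $h:\mathcal{S}\to 2^{[n]}$ be a function with $h(S)\subseteq S$ for every $S\in\mathcal{S}$, and suppose that $\mathcal{F}(\mathcal{S},h)$ is s-extremal. Then there exists $F\notin\mathcal{F}(\mathcal{S},h)$ such that $\mathcal{F}(\mathcal{S},h)\cup\{F\}$ is again s-extremal.
   Context: $[n]=\{1,\dots,n\}$. A family $\mathcal{F}\subseteq 2^{[n]}$ shatters $S\subseteq[n]$ if $\{F\cap S: F\in\mathcal{F}\}=2^S$; $\mathrm{Sh}(\mathcal{F})$ is the family of sets shattered by $\mathcal{F}$. $\mathcal{F}$ is s-extremal if $|\mathrm{Sh}(\mathcal{F})|=|\mathcal{F}|$. A Sperner family is a family none of whose members contains another. For $H\subseteq S\subseteq[n]$ let $\mathcal{Q}_{S,H}=\{H\cup B: B\subseteq[n]\setminus S\}$, and define $\mathcal{F}(\mathcal{S},h)=2^{[n]}\setminus\bigcup_{S\in\mathcal{S}}\mathcal{Q}_{S,h(S)}$. -}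

module Defs where

open import Data.Bool using (Bool; true; false; _∧_; _∨_; not; if_then_else_)
import Data.Bool as B
open import Data.Nat using (ℕ; zero; suc; _+_)
open import Data.List using (List; []; _∷_; map; _++_)
open import Data.Bool.ListAction using (any; all)
open import Data.Nat.ListAction using (sum)
open import Data.Vec using (_∷_; [])
open import Data.Fin.Subset using (Subset; _⊆_; _∩_; _∪_; ⊥; inside; outside)
open import Data.Fin.Subset.Properties using (_⊆?_)
open import Data.Vec.Properties using (≡-dec)
open import Relation.Nullary.Decidable using (⌊_⌋)

Family : ℕ → Set
Family n = Subset n → Bool

allSubsets : (n : ℕ) → List (Subset n)
allSubsets zero = [] ∷ []
allSubsets (suc n) = map (outside ∷_) (allSubsets n) ++ map (inside ∷_) (allSubsets n)

_==_ : {n : ℕ} → Subset n → Subset n → Bool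
A == B = ⌊ ≡-dec B._≟_ A B ⌋

_⊆ᵇ_ : {n : ℕ} → Subset n → Subset n → Bool
A ⊆ᵇ B = ⌊ A ⊆? B ⌋

card : {n : ℕ} → Family n → ℕ
card {n} 𝓕 = sum (map (λ X → if 𝓕 X then 1 else 0) (allSubsets n))

-- 𝓕 shatters S  iff  {F ∩ S : F ∈ 𝓕} = 2^S, i.e. every T ⊆ S is F ∩ S for some F ∈ 𝓕
-- (the inclusion {F ∩ S} ⊆ 2^S is automatic).
shatters : {n : ℕ} → Family n → Subset n → Bool
shatters {n} 𝓕 S =
  all (λ T → not (T ⊆ᵇ S) ∨ any (λ F → 𝓕 F ∧ ((F ∩ S) == T)) (allSubsets n)) (allSubsets n)

Sh : {n : ℕ} → Family n → Family n
Sh 𝓕 S = shatters 𝓕 S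

SExtremal : {n : ℕ} → Family n → Set
SExtremal 𝓕 = card (Sh 𝓕) ≡ card 𝓕
  where open import Relation.Binary.PropositionalEquality using (_≡_)

inQ : {n : ℕ} → Subset n → Subset n → Subset n → Bool
inQ {n} S H X = any (λ Bs → ((Bs ∩ S) == ⊥) ∧ (X == (H ∪ Bs))) (allSubsets n)

FSh : {n : ℕ} → Family n → (Subset n → Subset n) → Family n
FSh {n} 𝒮 h X = not (any (λ S → 𝒮 S ∧ inQ S (h S) X) (allSubsets n))

addSet : {n : ℕ} → Family n → Subset n → Family n
addSet 𝓕 F X = 𝓕 X ∨ (X == F)

{-# OPTIONS --safe #-}
module Submission where

-- The complement G of 𝓕(𝒮,h) is a union of K ≤ 4 subcubes Q_i = Q_{S_i,h(S_i)}.
-- If v ∈ Q_i leaves G whenever a coordinate in S_i is flipped (a simple corner),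
-- then S_i is the only set that adding v can newly shatter, so by Pajor's
-- inequality 𝓕(𝒮,h) ∪ {v} is again s-extremal. On the other hand an s-extremal
-- family has no gap, i.e. no members u, w at distance ≥ 2 with every other point
-- of the subcube they span outside the family. It remains to see that at most four
-- subcubes with incomparable S_i and without a simple corner produce a gap. Only
-- the columns of the K × n matrix over {0,1,*} that describes the subcubes matter,
-- and a verified case search shows that some five or fewer columns always exhibit
-- either a simple corner or a gap.

open import Defs
open import Data.Bool using (Bool; true; false; _∧_; _∨_; _xor_; not; T; T?; if_then_else_)
import Data.Bool as Bool
open import Data.Bool.ListAction using (any; all)
open import Data.Bool.Properties
  using (T-≡; T-∧; T-∨; ∨-identityʳ; ∧-identityʳ; ∧-zeroʳ; not-injective; not-¬; ¬-not; not-involutive; T-not-≡; xor-same; xor-assoc)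
open import Data.Empty using (⊥-elim)
open import Data.Fin using (Fin; zero; suc; _≟_)
open import Data.Fin.Properties using (any?; all?)
open import Data.Fin.Subset using (Subset; _⊆_; _∩_; _∪_; ∁; ⊥; inside; outside; ⁅_⁆)
import Data.Fin.Subset as Subset
open import Data.Fin.Subset.Properties
  using (anySubset?; p∩q⊆q; _⊆?_; ∉⊥; x∈⁅x⁆; x∈⁅y⁆⇒x≡y)
open import Data.List using (List; []; _∷_; _++_; filter)
import Data.List as List
open import Data.List.Membership.Propositional using (_∈_; lose)
open import Data.List.Membership.Propositional.Properties
  using (∈-++⁺ˡ; ∈-++⁺ʳ; ∈-map⁺; ∈-map⁻; ∈-allFin; ∈-filter⁺; ∈-filter⁻; ∈-lookup)
import Data.List.Properties as List
import Data.List.Relation.Unary.All as All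
open import Data.List.Relation.Unary.All.Properties using (all⁺; all⁻)
import Data.List.Relation.Unary.AllPairs as AllPairs
open import Data.List.Relation.Unary.Any using (here; there; satisfied; index)
open import Data.List.Relation.Unary.Any.Properties using (any⁺; any⁻; lookup-index)
open import Data.List.Relation.Unary.Unique.Propositional using (Unique)
import Data.List.Relation.Unary.Unique.Propositional.Properties as Unique
open import Data.Maybe using (Maybe; just; nothing; is-just; fromMaybe)
import Data.Maybe as Maybe
open import Data.Nat using (ℕ; zero; suc; _+_; _≤_; z≤n; s≤s; _≤?_)
import Data.Nat as Nat
open import Data.Nat.ListAction using (sum)
open import Data.Nat.ListAction.Properties using (sum-++)
open import Data.Nat.Properties
  using (≤-refl; ≤-trans; ≤-antisym; ≤-reflexive; +-mono-≤; +-comm; +-suc; +-identityʳ;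
         m≤n⇒m≤1+n; 1+n≰n; +-cancelˡ-≤; +-cancelʳ-≤; +-monoˡ-≤; +-monoʳ-≤; module ≤-Reasoning)
open import Data.Nat.Solver using (module +-*-Solver)
open import Data.Product using (Σ; ∃; _×_; _,_; proj₁; proj₂)
open import Data.Sum using (_⊎_; inj₁; inj₂)
open import Data.Unit using (⊤; tt)
open import Data.Vec
  using (Vec; []; _∷_; lookup; map; replicate; tabulate; zipWith; _[_]≔_; _[_]%=_)
open import Data.Vec.Properties
  using (≡-dec; lookup-map; lookup-zipWith; lookup-replicate; lookup∘tabulate; tabulate∘lookup;
         tabulate-cong; lookup∘update; lookup∘update′; lookup∘updateAt; lookup∘updateAt′;
         []=⇒lookup; lookup⇒[]=; ∷-injectiveʳ)
open import Function using (_∘_; Equivalence)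
open import Relation.Binary.PropositionalEquality
open import Relation.Nullary using (¬_; Dec; yes; no; contradiction)
open import Relation.Nullary.Decidable
  using (⌊_⌋; toWitness; fromWitness; _×-dec_; _⊎-dec_; ¬?; decidable-stable)

private
  variable
    K m n : ℕ

-- Booleans, finite quantifiers and inclusion of sets

lookup-ext : ∀ {A : Set} {xs ys : Vec A n} → (∀ p → lookup xs p ≡ lookup ys p) → xs ≡ ys
lookup-ext {xs = xs} {ys} eq =
  trans (sym (tabulate∘lookup xs)) (trans (tabulate-cong eq) (tabulate∘lookup ys))

bool-ext : ∀ {a b} → (a ≡ true → b ≡ true) → (b ≡ true → a ≡ true) → a ≡ b
bool-ext {false} {false} _ _ = refl
bool-ext {false} {true}  _ g = g refl
bool-ext {true}  {b}     f _ = sym (f refl)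

∨-elim : ∀ {a b} → a ∨ b ≡ true → a ≡ true ⊎ b ≡ true
∨-elim {true}  _ = inj₁ refl
∨-elim {false} b = inj₂ b

∨-introˡ : ∀ {a b} → a ≡ true → a ∨ b ≡ true
∨-introˡ refl = refl

∨-introʳ : ∀ {a b} → b ≡ true → a ∨ b ≡ true
∨-introʳ {true}  _ = refl
∨-introʳ {false} b = b

∧-elim : ∀ {a b} → a ∧ b ≡ true → a ≡ true × b ≡ true
∧-elim {true} b = refl , b

∧-intro : ∀ {a b} → a ≡ true → b ≡ true → a ∧ b ≡ true
∧-intro refl b = b

module _ {A : Set} {a? : Dec A} where

  ⌊⌋-intro : A → ⌊ a? ⌋ ≡ true
  ⌊⌋-intro x = Equivalence.to T-≡ (fromWitness {a? = a?} x)

  ⌊⌋-elim : ⌊ a? ⌋ ≡ true → A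
  ⌊⌋-elim t = toWitness {a? = a?} (Equivalence.from T-≡ t)

==-refl : (A : Subset n) → (A == A) ≡ true
==-refl A = ⌊⌋-intro {a? = ≡-dec Bool._≟_ A A} refl

==⇒≡ : {A B : Subset n} → (A == B) ≡ true → A ≡ B
==⇒≡ {A = A} {B} = ⌊⌋-elim {a? = ≡-dec Bool._≟_ A B}

∈-allSubsets : (X : Subset n) → X ∈ allSubsets n
∈-allSubsets []          = here refl
∈-allSubsets (false ∷ X) = ∈-++⁺ˡ (∈-map⁺ (outside ∷_) (∈-allSubsets X))
∈-allSubsets (true ∷ X)  = ∈-++⁺ʳ _ (∈-map⁺ (inside ∷_) (∈-allSubsets X))

module _ {f : Subset n → Bool} where

  any-intro : ∀ X → f X ≡ true → any f (allSubsets n) ≡ true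
  any-intro X fX = Equivalence.to T-≡ (any⁺ f (lose (∈-allSubsets X) (Equivalence.from T-≡ fX)))

  any-elim : any f (allSubsets n) ≡ true → ∃ λ X → f X ≡ true
  any-elim t = let X , fX = satisfied (any⁻ f (allSubsets n) (Equivalence.from T-≡ t)) in X , Equivalence.to T-≡ fX

  all-intro : (∀ X → f X ≡ true) → all f (allSubsets n) ≡ true
  all-intro fX = Equivalence.to T-≡ (all⁻ f {xs = allSubsets n} (All.tabulate λ {X} _ → Equivalence.from T-≡ (fX X)))

  all-elim : all f (allSubsets n) ≡ true → ∀ X → f X ≡ true
  all-elim t X = Equivalence.to T-≡ (All.lookup (all⁺ f (allSubsets n) (Equivalence.from T-≡ t)) (∈-allSubsets X))

⊆⇒lookup : {A B : Subset n} → A ⊆ B → ∀ p → lookup A p ≡ true → lookup B p ≡ true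
⊆⇒lookup A⊆B p Ap = []=⇒lookup (A⊆B (lookup⇒[]= p _ Ap))

lookup⇒⊆ : {A B : Subset n} → (∀ p → lookup A p ≡ true → lookup B p ≡ true) → A ⊆ B
lookup⇒⊆ sub {p} p∈A = lookup⇒[]= p _ (sub p ([]=⇒lookup p∈A))

-- Shattering and cardinality

Agree : Subset n → Subset n → Subset n → Set
Agree S X Y = ∀ p → lookup S p ≡ true → lookup X p ≡ lookup Y p

-- The trace `T` is arbitrary and compared on `S` only, so no inclusion `T ⊆ S` has to be carried
-- along.
Shatters : Family n → Subset n → Set
Shatters {n} F S = (T : Subset n) → ∃ λ X → F X ≡ true × Agree S X T

Shatters⇒Sh : (F : Family n) (S : Subset n) → Shatters F S → Sh F S ≡ true
Shatters⇒Sh {n} F S sh = all-intro traced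
  where
  trace≡ : ∀ {X T} → T ⊆ S → Agree S X T → X ∩ S ≡ T
  trace≡ {X} {T} T⊆S agree = lookup-ext λ p → trans (lookup-zipWith _∧_ p X S) (pointwise p)
    where
    pointwise : ∀ p → lookup X p ∧ lookup S p ≡ lookup T p
    pointwise p with lookup S p in Sp | lookup T p in Tp
    ... | true  | t     = trans (∧-identityʳ _) (trans (agree p Sp) Tp)
    ... | false | false = ∧-zeroʳ _
    ... | false | true  with () ← trans (sym Sp) (⊆⇒lookup T⊆S p Tp)
  traced : ∀ T → not (T ⊆ᵇ S) ∨ any (λ X → F X ∧ ((X ∩ S) == T)) (allSubsets n) ≡ true
  traced T with T ⊆ᵇ S in T⊆S
  ... | false = refl
  ... | true with X , FX , agree ← sh T = any-intro X (∧-intro FX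
    (⌊⌋-intro {a? = ≡-dec Bool._≟_ (X ∩ S) T} (trace≡ (⌊⌋-elim {a? = T ⊆? S} T⊆S) agree)))

Sh⇒Shatters : (F : Family n) (S : Subset n) → Sh F S ≡ true → Shatters F S
Sh⇒Shatters {n} F S sh T with ∨-elim (all-elim sh (T ∩ S))
... | inj₁ ⊈ with () ← trans (cong not (sym (⌊⌋-intro {a? = (T ∩ S) ⊆? S} (p∩q⊆q T S)))) ⊈
... | inj₂ t with X , t′ ← any-elim t with FX , eq ← ∧-elim t′ = X , FX , agree
  where
  agree : Agree S X T
  agree p Sp = trans (sym (restrict X)) (trans (cong (λ Y → lookup Y p) (==⇒≡ eq)) (restrict T))
    where
    restrict : ∀ Y → lookup (Y ∩ S) p ≡ lookup Y p
    restrict Y = trans (lookup-zipWith _∧_ p Y S) (trans (cong (lookup Y p ∧_) Sp) (∧-identityʳ _))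

-- Cardinalities of families

card-suc : (F : Family (suc n)) → card F ≡ card (F ∘ (outside ∷_)) + card (F ∘ (inside ∷_))
card-suc {n} F = begin
  sum (List.map χ (O ++ I))             ≡⟨ cong sum (List.map-++ χ O I) ⟩
  sum (List.map χ O ++ List.map χ I)    ≡⟨ sum-++ (List.map χ O) _ ⟩
  sum (List.map χ O) + sum (List.map χ I)
    ≡⟨ cong₂ (λ xs ys → sum xs + sum ys) (List.map-∘ (allSubsets n)) (List.map-∘ (allSubsets n)) ⟨
  card (F ∘ (outside ∷_)) + card (F ∘ (inside ∷_)) ∎
  where
  open ≡-Reasoning
  χ : Subset (suc n) → ℕ
  χ X = if F X then 1 else 0
  O I : List (Subset (suc n))
  O = List.map (outside ∷_) (allSubsets n)
  I = List.map (inside ∷_) (allSubsets n)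

card-cong : {F G : Family n} → F ≗ G → card F ≡ card G
card-cong {n} F≗G = cong sum (List.map-cong (λ X → cong (λ b → if b then 1 else 0) (F≗G X)) (allSubsets n))

interchange : ∀ a b c d → (a + b) + (c + d) ≡ (a + c) + (b + d)
interchange = solve 4 (λ a b c d → (a :+ b) :+ (c :+ d) := (a :+ c) :+ (b :+ d)) refl
  where open +-*-Solver

-- Inclusion and exclusion: the two sides count unions plus intersections, which the hypotheses
-- compare. In terms of indicator functions the bound holds at each point, and the recursion on `n`
-- sums it up.
card-+-mono : (A B C D : Family n) →
  (∀ X → A X ∨ B X ≡ true → C X ∨ D X ≡ true) →
  (∀ X → A X ∧ B X ≡ true → C X ∧ D X ≡ true) →
  card A + card B ≤ card C + card D
card-+-mono {zero} A B C D or and with A [] | B [] | C [] | D [] | or [] | and []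
... | false | false | _     | _     | _  | _   = z≤n
... | true  | true  | true  | true  | _  | _   = ≤-refl
... | true  | true  | true  | false | _  | and′ with () ← and′ refl
... | true  | true  | false | _     | _  | and′ with () ← and′ refl
... | true  | false | true  | _     | _  | _   = s≤s z≤n
... | true  | false | false | true  | _  | _   = s≤s z≤n
... | true  | false | false | false | or′ | _ with () ← or′ refl
... | false | true  | true  | _     | _  | _   = s≤s z≤n
... | false | true  | false | true  | _  | _   = s≤s z≤n
... | false | true  | false | false | or′ | _ with () ← or′ refl
card-+-mono {suc n} A B C D or and
  rewrite card-suc A | card-suc B | card-suc C | card-suc D
  | interchange (card (A ∘ (outside ∷_))) (card (A ∘ (inside ∷_))) (card (B ∘ (outside ∷_))) (card (B ∘ (inside ∷_)))
  | interchange (card (C ∘ (outside ∷_))) (card (C ∘ (inside ∷_))) (card (D ∘ (outside ∷_))) (card (D ∘ (inside ∷_)))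
  = +-mono-≤ (half outside) (half inside)
  where
  half : ∀ b → card (A ∘ (b ∷_)) + card (B ∘ (b ∷_)) ≤ card (C ∘ (b ∷_)) + card (D ∘ (b ∷_))
  half b = card-+-mono _ _ _ _ (or ∘ (b ∷_)) (and ∘ (b ∷_))

card-superadditive : (A B C D : Family n) →
  (∀ X → A X ≡ true ⊎ B X ≡ true → C X ≡ true) →
  (∀ X → A X ≡ true → B X ≡ true → D X ≡ true) →
  card A + card B ≤ card C + card D
card-superadditive A B C D or and = card-+-mono A B C D
  (λ X a∨b → ∨-introˡ (or X (∨-elim a∨b)))
  (λ X a∧b → let a , b = ∧-elim a∧b in ∧-intro (or X (inj₁ a)) (and X a b))

∅ : Family n
∅ _ = false

card-∅ : ∀ n → card {n} ∅ ≡ 0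
card-∅ zero    = refl
card-∅ (suc n) = trans (card-suc {n} ∅) (cong₂ _+_ (card-∅ n) (card-∅ n))

card-disjoint : (A B C : Family n) → (∀ X → A X ≡ true ⊎ B X ≡ true → C X ≡ true) →
  (∀ X → A X ≡ true → B X ≢ true) → card A + card B ≤ card C
card-disjoint {n} A B C or disjoint = subst (card A + card B ≤_)
  (trans (cong (card C +_) (card-∅ n)) (+-identityʳ _))
  (card-superadditive A B C ∅ or λ X a b → contradiction b (disjoint X a))

card-mono : (F G : Family n) → (∀ X → F X ≡ true → G X ≡ true) → card F ≤ card G
card-mono {n} F G sub = subst (_≤ card G)
  (trans (cong (card F +_) (card-∅ n)) (+-identityʳ _))
  (card-disjoint F ∅ G (λ { X (inj₁ f) → sub X f }) λ _ _ ())

addSet-cons : (F : Family (suc n)) (a b : Bool) (A X : Subset n) → a ≡ b →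
  addSet F (a ∷ A) (b ∷ X) ≡ addSet (F ∘ (b ∷_)) A X
addSet-cons F a .a A X refl = cong (F (a ∷ X) ∨_) (bool-ext
  (λ eq → subst (λ Y → (X == Y) ≡ true) (∷-injectiveʳ (==⇒≡ eq)) (==-refl X))
  (λ eq → subst (λ Y → ((a ∷ X) == (a ∷ Y)) ≡ true) (==⇒≡ eq) (==-refl (a ∷ X))))

addSet-cons-≢ : (F : Family (suc n)) (a b : Bool) (A X : Subset n) → a ≢ b →
  addSet F (a ∷ A) (b ∷ X) ≡ F (b ∷ X)
addSet-cons-≢ F a b A X a≢b with ((b ∷ X) == (a ∷ A)) in eq
... | false = ∨-identityʳ _
... | true with refl ← ==⇒≡ eq = contradiction refl a≢b

card-addSet : (F : Family n) (A : Subset n) → F A ≡ false → card (addSet F A) ≡ suc (card F)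
card-addSet F [] FA rewrite FA = refl
card-addSet F (false ∷ A) FA = begin
  card (addSet F (false ∷ A))
    ≡⟨ card-suc (addSet F (false ∷ A)) ⟩
  _ ≡⟨ cong₂ _+_ (card-cong λ X → addSet-cons F false false A X refl)
                 (card-cong λ X → addSet-cons-≢ F false true A X λ ()) ⟩
  card (addSet (F ∘ (outside ∷_)) A) + card (F ∘ (inside ∷_))
    ≡⟨ cong (_+ _) (card-addSet (F ∘ (outside ∷_)) A FA) ⟩
  suc (card (F ∘ (outside ∷_)) + card (F ∘ (inside ∷_)))
    ≡⟨ cong suc (card-suc F) ⟨
  suc (card F) ∎
  where open ≡-Reasoning
card-addSet F (true ∷ A) FA = begin
  card (addSet F (true ∷ A))
    ≡⟨ card-suc (addSet F (true ∷ A)) ⟩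
  _ ≡⟨ cong₂ _+_ (card-cong λ X → addSet-cons-≢ F true false A X λ ())
                 (card-cong λ X → addSet-cons F true true A X refl) ⟩
  card (F ∘ (outside ∷_)) + card (addSet (F ∘ (inside ∷_)) A)
    ≡⟨ cong (_ +_) (card-addSet (F ∘ (inside ∷_)) A FA) ⟩
  card (F ∘ (outside ∷_)) + suc (card (F ∘ (inside ∷_)))
    ≡⟨ +-suc _ _ ⟩
  suc (card (F ∘ (outside ∷_)) + card (F ∘ (inside ∷_)))
    ≡⟨ cong suc (card-suc F) ⟨
  suc (card F) ∎
  where open ≡-Reasoning

card-addSet-≤ : (F : Family n) (A : Subset n) → card (addSet F A) ≤ suc (card F)
card-addSet-≤ F A with F A in FA
... | false = ≤-reflexive (card-addSet F A FA)
... | true  = m≤n⇒m≤1+n (card-mono (addSet F A) F λ X t → absorbed X (∨-elim t))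
  where
  absorbed : ∀ X → F X ≡ true ⊎ (X == A) ≡ true → F X ≡ true
  absorbed X (inj₁ FX) = FX
  absorbed X (inj₂ eq) = trans (cong F (==⇒≡ eq)) FA

-- Pajor's inequality.
card≤card-Sh : (F : Family n) → card F ≤ card (Sh F)
card≤card-Sh {zero} F = card-mono F (Sh F) λ { [] F[] → Shatters⇒Sh F [] λ T → [] , F[] , λ () }
card≤card-Sh {suc n} F = begin
  card F                      ≡⟨ card-suc F ⟩
  card F₀ + card F₁           ≤⟨ +-mono-≤ (card≤card-Sh F₀) (card≤card-Sh F₁) ⟩
  -- A set shattered by one half is shattered by `F` without the first coordinate; a set shattered
  -- by both halves is also shattered with it.
  card (Sh F₀) + card (Sh F₁) ≤⟨ card-superadditive (Sh F₀) (Sh F₁) _ _ either both ⟩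
  card (Sh F ∘ (outside ∷_)) + card (Sh F ∘ (inside ∷_)) ≡⟨ card-suc (Sh F) ⟨
  card (Sh F)                 ∎
  where
  open ≤-Reasoning
  F₀ F₁ : Family n
  F₀ = F ∘ (outside ∷_)
  F₁ = F ∘ (inside ∷_)
  lift-out : ∀ b S → Sh (F ∘ (b ∷_)) S ≡ true → Sh F (outside ∷ S) ≡ true
  lift-out b S sh = Shatters⇒Sh F (outside ∷ S) λ { (t ∷ T) →
    let X , FX , agree = Sh⇒Shatters (F ∘ (b ∷_)) S sh T in b ∷ X , FX , λ { (suc p) → agree p } }
  either : ∀ S → Sh F₀ S ≡ true ⊎ Sh F₁ S ≡ true → Sh F (outside ∷ S) ≡ true
  either S (inj₁ sh) = lift-out false S sh
  either S (inj₂ sh) = lift-out true S sh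
  both : ∀ S → Sh F₀ S ≡ true → Sh F₁ S ≡ true → Sh F (inside ∷ S) ≡ true
  both S sh₀ sh₁ = Shatters⇒Sh F (inside ∷ S) λ where
    (false ∷ T) → let X , FX , agree = Sh⇒Shatters F₀ S sh₀ T
                  in false ∷ X , FX , λ { zero _ → refl ; (suc p) → agree p }
    (true ∷ T)  → let X , FX , agree = Sh⇒Shatters F₁ S sh₁ T
                  in true ∷ X , FX , λ { zero _ → refl ; (suc p) → agree p }

-- Slices along a coordinate

toggle : Fin n → Subset n → Subset n
toggle e X = X [ e ]%= not

card-toggle : (e : Fin n) (F : Family n) → card (F ∘ toggle e) ≡ card F
card-toggle zero    F = trans (card-suc (F ∘ toggle zero))
  (trans (+-comm (card (F ∘ (inside ∷_))) _) (sym (card-suc F)))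
card-toggle (suc e) F = trans (card-suc (F ∘ toggle (suc e)))
  (trans (cong₂ _+_ (card-toggle e (F ∘ (outside ∷_))) (card-toggle e (F ∘ (inside ∷_))))
         (sym (card-suc F)))

lookup-toggle : (e : Fin n) (X : Subset n) → lookup (toggle e X) e ≡ not (lookup X e)
lookup-toggle e X = lookup∘updateAt e X

lookup-toggle-≢ : ∀ {p e : Fin n} → p ≢ e → (X : Subset n) → lookup (toggle e X) p ≡ lookup X p
lookup-toggle-≢ {p = p} {e} p≢e X = lookup∘updateAt′ p e p≢e X

-- The ground set stays the same, so that slices at several coordinates can be iterated.
slice : Fin n → Bool → Family n → Family n
slice e b F X = F X ∧ ⌊ lookup X e Bool.≟ b ⌋

slice-elim : ∀ e b (F : Family n) {X} → slice e b F X ≡ true → F X ≡ true × lookup X e ≡ b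
slice-elim e b F {X} t = let FX , eq = ∧-elim t in FX , ⌊⌋-elim {a? = lookup X e Bool.≟ b} eq

slice-intro : ∀ e b (F : Family n) {X} → F X ≡ true → lookup X e ≡ b → slice e b F X ≡ true
slice-intro e b F {X} FX eq = ∧-intro FX (⌊⌋-intro {a? = lookup X e Bool.≟ b} eq)

Sh-slice-∌ : ∀ e b (F : Family n) {S} → Sh (slice e b F) S ≡ true → lookup S e ≡ false
Sh-slice-∌ {n} e b F {S} sh with lookup S e in Se
... | false = refl
... | true  = contradiction (trans (sym Xe) (trans (agree e Se) (lookup-replicate e (not b)))) (b≢not b)
  where
  -- The constant set with value `not b` asks at `e` for the value that the slice excludes.
  X = Sh⇒Shatters (slice e b F) S sh (replicate n (not b))
  agree = proj₂ (proj₂ X)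
  Xe : lookup (proj₁ X) e ≡ b
  Xe = proj₂ (slice-elim e b F (proj₁ (proj₂ X)))
  b≢not : ∀ b → b ≢ not b
  b≢not false ()
  b≢not true  ()

Sh-mono : {F G : Family n} → (∀ X → F X ≡ true → G X ≡ true) → ∀ S → Sh F S ≡ true → Sh G S ≡ true
Sh-mono {F = F} {G} sub S sh = Shatters⇒Sh G S λ T →
  let X , FX , agree = Sh⇒Shatters F S sh T in X , sub X FX , agree

-- A set shattered by both slices stays shattered by F after inserting e.
Sh-slices : (e : Fin n) (F : Family n) →
  card (Sh (slice e false F)) + card (Sh (slice e true F)) ≤ card (Sh F)
Sh-slices {n} e F = begin
  card A + card B                ≤⟨ card-superadditive A B C D either both ⟩
  -- Members of `D` avoid `e`. Toggling inserts `e` into them, which keeps their number and makes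
  -- them disjoint from `C`.
  card C + card D                ≡⟨ cong (card C +_) (card-toggle e D) ⟨
  card C + card (D ∘ toggle e)   ≤⟨ card-disjoint C (D ∘ toggle e) (Sh F) sub disjoint ⟩
  card (Sh F)                    ∎
  where
  open ≤-Reasoning
  A B C D : Family n
  A = Sh (slice e false F)
  B = Sh (slice e true F)
  C S = A S ∨ B S
  D S = A S ∧ B S
  either : ∀ S → A S ≡ true ⊎ B S ≡ true → C S ≡ true
  either S (inj₁ a) = ∨-introˡ a
  either S (inj₂ b) = ∨-introʳ b
  both : ∀ S → A S ≡ true → B S ≡ true → D S ≡ true
  both S = ∧-intro
  C-∌ : ∀ S → C S ≡ true → lookup S e ≡ false
  C-∌ S c with ∨-elim c
  ... | inj₁ a = Sh-slice-∌ e false F a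
  ... | inj₂ b = Sh-slice-∌ e true F b
  D-∋ : ∀ S → D (toggle e S) ≡ true → lookup S e ≡ true
  D-∋ S d = not-injective (trans (sym (lookup-toggle e S)) (Sh-slice-∌ e false F (proj₁ (∧-elim d))))
  disjoint : ∀ S → C S ≡ true → D (toggle e S) ≢ true
  disjoint S c d with () ← trans (sym (C-∌ S c)) (D-∋ S d)
  sub : ∀ S → C S ≡ true ⊎ D (toggle e S) ≡ true → Sh F S ≡ true
  sub S (inj₁ c) with ∨-elim c
  ... | inj₁ a = Sh-mono (λ X → proj₁ ∘ slice-elim e false F) S a
  ... | inj₂ b = Sh-mono (λ X → proj₁ ∘ slice-elim e true F) S b
  sub S (inj₂ d) = Shatters⇒Sh F S λ T → pick T (lookup T e) refl
    where
    shattered : ∀ b → Sh (slice e b F) (toggle e S) ≡ true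
    shattered false = proj₁ (∧-elim d)
    shattered true  = proj₂ (∧-elim d)
    pick : ∀ T b → lookup T e ≡ b → ∃ λ X → F X ≡ true × Agree S X T
    pick T b Te with X , sX , agree ← Sh⇒Shatters (slice e b F) (toggle e S) (shattered b) T
      with FX , Xe ← slice-elim e b F sX = X , FX , agree′
      where
      agree′ : Agree S X T
      agree′ p Sp with p ≟ e
      ... | yes refl = trans Xe (sym Te)
      ... | no p≢e   = agree p (trans (lookup-toggle-≢ p≢e S) Sp)

card-slices : (e : Fin n) (F : Family n) →
  card F ≤ card (slice e false F) + card (slice e true F)
card-slices {n} e F = subst (_≤ card (slice e false F) + card (slice e true F))
  (trans (cong (card F +_) (card-∅ n)) (+-identityʳ _))
  (card-+-mono F ∅ _ _
    (λ X FX → covered X (trans (sym (∨-identityʳ (F X))) FX) (lookup X e) refl)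
    (λ X FX∧false → contradiction (trans (sym (∧-zeroʳ (F X))) FX∧false) λ ()))
  where
  covered : ∀ X → F X ≡ true → ∀ b → lookup X e ≡ b → slice e false F X ∨ slice e true F X ≡ true
  covered X FX false Xe = ∨-introˡ (slice-intro e false F FX Xe)
  covered X FX true  Xe = ∨-introʳ (slice-intro e true F FX Xe)

-- By `Sh-slices` and extremality of `F`, the two slices together shatter at most as many sets as
-- they have members. Pajor's inequality for each slice then forces equality in both.
SExtremal-slice : ∀ e b (F : Family n) → SExtremal F → SExtremal (slice e b F)
SExtremal-slice {n} e b F ext = ≤-antisym (bound b) (card≤card-Sh (slice e b F))
  where
  open ≤-Reasoning
  f s : Bool → ℕ
  f b = card (slice e b F)
  s b = card (Sh (slice e b F))
  total : s false + s true ≤ f false + f true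
  total = ≤-trans (Sh-slices e F) (≤-trans (≤-reflexive ext) (card-slices e F))
  bound : ∀ b → s b ≤ f b
  bound false = +-cancelʳ-≤ (s true) _ _
    (≤-trans total (+-monoʳ-≤ (f false) (card≤card-Sh (slice e true F))))
  bound true  = +-cancelˡ-≤ (s false) _ _
    (≤-trans total (+-monoˡ-≤ (f true) (card≤card-Sh (slice e false F))))

-- Restriction to the subcube spanned by two sets

interval : Family n → Subset n → Subset n → List (Fin n) → Family n
interval F u w []       = F
interval F u w (e ∷ es) with lookup u e Bool.≟ lookup w e
-- Fixing every coordinate where `u` and `w` agree leaves exactly the members between them.
... | yes _ = slice e (lookup u e) (interval F u w es)
... | no _  = interval F u w es

SExtremal-interval : (F : Family n) (u w : Subset n) (es : List (Fin n)) →
  SExtremal F → SExtremal (interval F u w es)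
SExtremal-interval F u w []       ext = ext
SExtremal-interval F u w (e ∷ es) ext with lookup u e Bool.≟ lookup w e
... | yes _ = SExtremal-slice e (lookup u e) (interval F u w es) (SExtremal-interval F u w es ext)
... | no _  = SExtremal-interval F u w es ext

interval-elim : (F : Family n) (u w : Subset n) (es : List (Fin n)) {X : Subset n} →
  interval F u w es X ≡ true →
  F X ≡ true × (∀ {e} → e ∈ es → lookup u e ≡ lookup w e → lookup X e ≡ lookup u e)
interval-elim F u w []       FX = FX , λ ()
interval-elim F u w (e ∷ es) t with lookup u e Bool.≟ lookup w e
... | yes _ with IX , Xe ← slice-elim e (lookup u e) (interval F u w es) t
            with FX , agree ← interval-elim F u w es IX =
  FX , λ { (here refl) _ → Xe ; (there e∈) → agree e∈ }
... | no ne with FX , agree ← interval-elim F u w es t =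
  FX , λ { (here refl) eq → contradiction eq ne ; (there e∈) → agree e∈ }

interval-intro : (F : Family n) (u w : Subset n) (es : List (Fin n)) {X : Subset n} →
  F X ≡ true → (∀ e → lookup u e ≡ lookup w e → lookup X e ≡ lookup u e) →
  interval F u w es X ≡ true
interval-intro F u w []       FX agree = FX
interval-intro F u w (e ∷ es) FX agree with lookup u e Bool.≟ lookup w e
... | yes eq = slice-intro e (lookup u e) (interval F u w es) (interval-intro F u w es FX agree) (agree e eq)
... | no _   = interval-intro F u w es FX agree

Between : Subset n → Subset n → Subset n → Set
Between u w X = ∀ p → lookup X p ≡ lookup u p ⊎ lookup X p ≡ lookup w p

-- Restricted to the subcube spanned by u and w, such a family would have two
-- members but shatter ∅, {p} and {q}.
SExtremal-no-gap : (F : Family n) → SExtremal F → (u w : Subset n) → F u ≡ true → F w ≡ true →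
  ∀ {p q} → p ≢ q → lookup u p ≢ lookup w p → lookup u q ≢ lookup w q →
  ¬ (∀ X → F X ≡ true → Between u w X → X ≡ u ⊎ X ≡ w)
SExtremal-no-gap {n} F ext u w Fu Fw {p} {q} p≢q up≢wp uq≢wq gap =
  1+n≰n (≤-trans three (≤-trans (≤-reflexive (SExtremal-interval F u w es ext)) two))
  where
  es : List (Fin n)
  es = List.allFin n
  I : Family n
  I = interval F u w es
  Iu : I u ≡ true
  Iu = interval-intro F u w es Fu λ _ _ → refl
  Iw : I w ≡ true
  Iw = interval-intro F u w es Fw λ _ → sym
  pair : Family n
  pair = addSet (addSet ∅ u) w
  I⊆pair : ∀ X → I X ≡ true → pair X ≡ true
  I⊆pair X IX with FX , agree ← interval-elim F u w es IX with gap X FX (between agree)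
    where
    between : (∀ {e} → e ∈ es → lookup u e ≡ lookup w e → lookup X e ≡ lookup u e) → Between u w X
    between agree p with lookup u p Bool.≟ lookup w p
    ... | yes eq = inj₁ (agree (∈-allFin p) eq)
    ... | no ne with lookup X p Bool.≟ lookup u p
    ...   | yes eq = inj₁ eq
    -- There are only two values: what differs from `u` where `u` and `w` differ equals `w`.
    ...   | no ne′ = inj₂ (trans (¬-not ne′) (sym (¬-not (ne ∘ sym))))
  ... | inj₁ refl = ∨-introˡ (∨-introʳ {false} (==-refl u))
  ... | inj₂ refl = ∨-introʳ (==-refl w)
  two : card I ≤ 2
  two = begin
    card I                       ≤⟨ card-mono I pair I⊆pair ⟩
    card pair                    ≤⟨ card-addSet-≤ (addSet ∅ u) w ⟩
    suc (card (addSet ∅ u))      ≤⟨ s≤s (card-addSet-≤ ∅ u) ⟩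
    suc (suc (card {n} ∅))       ≡⟨ cong (2 +_) (card-∅ n) ⟩
    2                            ∎
    where open ≤-Reasoning
  singletons : Family n
  singletons = addSet (addSet (addSet ∅ ⊥) ⁅ p ⁆) ⁅ q ⁆
  shatters-∅ : Sh I ⊥ ≡ true
  shatters-∅ = Shatters⇒Sh I ⊥ λ T → u , Iu , λ r r∈ → contradiction (trans (sym (lookup-replicate r false)) r∈) λ ()
  shatters-⁅⁆ : ∀ {r} → lookup u r ≢ lookup w r → Sh I ⁅ r ⁆ ≡ true
  shatters-⁅⁆ {r} ne = Shatters⇒Sh I ⁅ r ⁆ λ T → choose T (lookup u r Bool.≟ lookup T r)
    where
    agree : ∀ {X T : Subset n} → lookup X r ≡ lookup T r → Agree ⁅ r ⁆ X T
    agree eq s s∈ with refl ← x∈⁅y⁆⇒x≡y r (lookup⇒[]= s ⁅ r ⁆ s∈) = eq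
    choose : ∀ T → Dec (lookup u r ≡ lookup T r) → ∃ λ X → I X ≡ true × Agree ⁅ r ⁆ X T
    -- As `u` and `w` differ at `r`, one of them realises the prescribed value there.
    choose T (yes eq) = u , Iu , agree {u} {T} eq
    choose T (no ne′) = w , Iw , agree {w} {T} (trans (¬-not (ne ∘ sym)) (sym (¬-not (ne′ ∘ sym))))
  singletons⊆Sh : ∀ S → singletons S ≡ true → Sh I S ≡ true
  singletons⊆Sh S t with ∨-elim t
  ... | inj₂ eq with refl ← ==⇒≡ {A = S} {⁅ q ⁆} eq = shatters-⁅⁆ uq≢wq
  ... | inj₁ t′ with ∨-elim t′
  ...   | inj₂ eq with refl ← ==⇒≡ {A = S} {⁅ p ⁆} eq = shatters-⁅⁆ up≢wp
  ...   | inj₁ eq with refl ← ==⇒≡ {A = S} {⊥} eq = shatters-∅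
  ≢⇒==-false : ∀ {A B : Subset n} → A ≢ B → (A == B) ≡ false
  ≢⇒==-false A≢B = ¬-not (A≢B ∘ ==⇒≡)
  ⁅⁆≢⊥ : ∀ r → ⁅ r ⁆ ≢ ⊥
  ⁅⁆≢⊥ r eq = ∉⊥ (subst (r Subset.∈_) eq (x∈⁅x⁆ r))
  three : 3 ≤ card (Sh I)
  three = begin
    3
      ≡⟨ cong (3 +_) (card-∅ n) ⟨
    suc (suc (suc (card {n} ∅)))
      ≡⟨ cong (2 +_) (card-addSet {n} ∅ ⊥ refl) ⟨
    suc (suc (card (addSet {n} ∅ ⊥)))
      ≡⟨ cong suc (card-addSet (addSet {n} ∅ ⊥) ⁅ p ⁆ (≢⇒==-false (⁅⁆≢⊥ p))) ⟨
    suc (card (addSet (addSet {n} ∅ ⊥) ⁅ p ⁆))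
      ≡⟨ card-addSet (addSet (addSet {n} ∅ ⊥) ⁅ p ⁆) ⁅ q ⁆
           (cong₂ _∨_ (≢⇒==-false (⁅⁆≢⊥ q))
             (≢⇒==-false (λ eq → p≢q (sym (x∈⁅y⁆⇒x≡y p (subst (q Subset.∈_) eq (x∈⁅x⁆ q))))))) ⟨
    card singletons
      ≤⟨ card-mono singletons (Sh I) singletons⊆Sh ⟩
    card (Sh I) ∎
    where open ≤-Reasoning

-- Adding a simple corner

module _ (F : Family n) (S v : Subset n)
  (subcube : ∀ X → Agree S X v → F X ≡ false)
  (edges : ∀ e → lookup S e ≡ true → F (toggle e v) ≡ true) where

  Agree-toggle : ∀ {R e} → lookup R e ≡ false → Agree R (toggle e v) v
  Agree-toggle {R} {e} Re p Rp with p ≟ e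
  ... | yes refl with () ← trans (sym Re) Rp
  ... | no p≢e   = lookup-toggle-≢ p≢e v

  -- If `R` is newly shattered, then `v` alone supplies its trace on `R`, so no member of `F` agrees
  -- with `v` on `R`. A point of `S` missing from `R` would give such a member by `edges`, hence
  -- `S ⊆ R`. For `p` in `R` but not in `S`, the trace of `toggle p v` on `R` would need a member of
  -- `F` in the subcube that `F` avoids.
  Sh-corner : ∀ R → Sh (addSet F v) R ≡ true → Sh F R ≢ true → R ≡ S
  Sh-corner R sh ¬sh = lookup-ext λ p → bool-ext (R⊆S p) (S⊆R p)
    where
    subcube′ : ∀ X → Agree R X v → F X ≢ true
    subcube′ X agree FX = ¬sh (Shatters⇒Sh F R trace)
      where
      trace : Shatters F R
      trace T with Y , t , agree′ ← Sh⇒Shatters (addSet F v) R sh T with ∨-elim t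
      ... | inj₁ FY = Y , FY , agree′
      ... | inj₂ eq with refl ← ==⇒≡ {A = Y} eq = X , FX , λ p Rp → trans (agree p Rp) (agree′ p Rp)
    S⊆R : ∀ p → lookup S p ≡ true → lookup R p ≡ true
    S⊆R p Sp with lookup R p in Rp
    ... | true  = refl
    ... | false = contradiction (edges p Sp) (subcube′ _ (Agree-toggle {R} Rp))
    R⊆S : ∀ p → lookup R p ≡ true → lookup S p ≡ true
    R⊆S p Rp with lookup S p in Sp
    ... | true  = refl
    ... | false with Y , t , agree ← Sh⇒Shatters (addSet F v) R sh (toggle p v) with ∨-elim t
    ...   | inj₁ FY with () ← trans (sym FY) (subcube Y λ q Sq →
                      trans (agree q (S⊆R q Sq)) (Agree-toggle {S} Sp q Sq))
    ...   | inj₂ eq with refl ← ==⇒≡ {A = Y} eq =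
              contradiction (trans (agree p Rp) (lookup-toggle p Y)) (not-¬ refl)

  -- The family gains exactly one member and at most one shattered set; Pajor's inequality gives the
  -- converse bound.
  SExtremal-addSet : SExtremal F → SExtremal (addSet F v)
  SExtremal-addSet ext = ≤-antisym upper (card≤card-Sh (addSet F v))
    where
    open ≤-Reasoning
    classify : ∀ R → Sh (addSet F v) R ≡ true → addSet (Sh F) S R ≡ true
    classify R sh with Sh F R in eq
    ... | true  = refl
    ... | false = trans (cong (_== S) (Sh-corner R sh λ sh′ → contradiction (trans (sym eq) sh′) λ ())) (==-refl S)
    upper : card (Sh (addSet F v)) ≤ card (addSet F v)
    upper = begin
      card (Sh (addSet F v))   ≤⟨ card-mono _ (addSet (Sh F) S) classify ⟩
      card (addSet (Sh F) S)   ≤⟨ card-addSet-≤ (Sh F) S ⟩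
      suc (card (Sh F))        ≡⟨ cong suc ext ⟩
      suc (card F)             ≡⟨ card-addSet F v (subcube v λ _ _ → refl) ⟨
      card (addSet F v)        ∎

-- Subcubes as agreement with H on S

inQ-intro : {S H X : Subset n} → H ⊆ S → Agree S X H → inQ S H X ≡ true
-- The part of `X` outside `S` serves as B; `H⊆S` ensures that the union adds nothing else there.
inQ-intro {S = S} {H} {X} H⊆S agree = any-intro (X ∩ ∁ S) (∧-intro
  (trans (cong (_== ⊥) (lookup-ext {ys = ⊥} disjoint)) (==-refl ⊥))
  (trans (cong (X ==_) (lookup-ext union)) (==-refl X)))
  where
  B : ∀ p → lookup (X ∩ ∁ S) p ≡ lookup X p ∧ not (lookup S p)
  B p = trans (lookup-zipWith _∧_ p X (∁ S)) (cong (lookup X p ∧_) (lookup-map p not S))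
  disjoint : ∀ p → lookup ((X ∩ ∁ S) ∩ S) p ≡ lookup ⊥ p
  disjoint p rewrite lookup-zipWith _∧_ p (X ∩ ∁ S) S | B p | lookup-replicate p false
    with lookup X p | lookup S p
  ... | false | _     = refl
  ... | true  | false = refl
  ... | true  | true  = refl
  union : ∀ p → lookup (H ∪ (X ∩ ∁ S)) p ≡ lookup X p
  union p rewrite lookup-zipWith _∨_ p H (X ∩ ∁ S) | B p with lookup S p in Sp | lookup H p in Hp
  ... | true  | h     = trans (cong (h ∨_) (∧-zeroʳ (lookup X p)))
                          (trans (∨-identityʳ h) (trans (sym Hp) (sym (agree p Sp))))
  ... | false | false = ∧-identityʳ _
  ... | false | true with () ← trans (sym Sp) (⊆⇒lookup H⊆S p Hp)

inQ-elim : {S H X : Subset n} → inQ S H X ≡ true → Agree S X H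
inQ-elim {S = S} {H} {X} t p Sp with B , t′ ← any-elim t with disjoint , union ← ∧-elim t′ = begin
  lookup X p               ≡⟨ cong (λ Y → lookup Y p) (==⇒≡ {A = X} union) ⟩
  lookup (H ∪ B) p         ≡⟨ lookup-zipWith _∨_ p H B ⟩
  lookup H p ∨ lookup B p  ≡⟨ cong (lookup H p ∨_) Bp ⟩
  lookup H p ∨ false       ≡⟨ ∨-identityʳ _ ⟩
  lookup H p               ∎
  where
  open ≡-Reasoning
  Bp : lookup B p ≡ false
  Bp = begin
    lookup B p               ≡⟨ ∧-identityʳ _ ⟨
    lookup B p ∧ true        ≡⟨ cong (lookup B p ∧_) Sp ⟨
    lookup B p ∧ lookup S p  ≡⟨ lookup-zipWith _∧_ p B S ⟨
    lookup (B ∩ S) p         ≡⟨ cong (λ Y → lookup Y p) (==⇒≡ disjoint) ⟩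
    lookup (⊥ {_}) p         ≡⟨ lookup-replicate p false ⟩
    false                    ∎

module _ (𝒮 : Family n) (h : Subset n → Subset n) where

  FSh-false-intro : (∀ S → 𝒮 S ≡ true → h S ⊆ S) →
    ∀ {S X} → 𝒮 S ≡ true → Agree S X (h S) → FSh 𝒮 h X ≡ false
  FSh-false-intro h⊆ {S} 𝒮S agree = cong not (any-intro S (∧-intro 𝒮S (inQ-intro (h⊆ S 𝒮S) agree)))

  FSh-false-elim : ∀ {X} → FSh 𝒮 h X ≡ false → ∃ λ S → 𝒮 S ≡ true × Agree S X (h S)
  FSh-false-elim eq with S , t ← any-elim (not-injective eq) with 𝒮S , q ← ∧-elim t =
    S , 𝒮S , inQ-elim q

-- Configurations of subcubes

-- The entry at i of the column of coordinate p is nothing if p ∉ S_i, and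
-- otherwise says whether p ∈ h(S_i).
Column : ℕ → Set
Column K = Vec (Maybe Bool) K

fits : Maybe Bool → Bool → Bool
fits nothing  b = true
fits (just a) b = not (a xor b)

fits-just : ∀ a b → T (fits (just a) b) → a ≡ b
fits-just false false _ = refl
fits-just true  true  _ = refl

On : Vec (Column K) n → Fin K → Subset n → Set
On M i X = ∀ p → T (fits (lookup (lookup M p) i) (lookup X p))

Fixed : Vec (Column K) n → Fin K → Fin n → Set
Fixed M i p = T (is-just (lookup (lookup M p) i))

Clash : Vec (Column K) n → Fin K → Subset n → Fin n → Set
Clash M j X p = ¬ T (fits (lookup (lookup M p) j) (lookup X p))

-- Equivalently v ∈ Q_i, and v with e flipped lies in no Q_j, for every e ∈ S_i.
SimpleCorner : Vec (Column K) n → Fin K → Subset n → Set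
SimpleCorner M i v =
  On M i v × (∀ j → j ≢ i → ∀ e → Fixed M i e → ∃ λ p → p ≢ e × Clash M j v p)

Far : Subset n → Subset n → Set
Far u w = ∃ λ p → ∃ λ q → p ≢ q × lookup u p ≢ lookup w p × lookup u q ≢ lookup w q

-- A vertex belongs to the family exactly when it lies on no subcube. All clauses are finite and
-- decidable, so gaps can be found by enumeration.
Gap : Vec (Column K) n → Subset n → Subset n → Set
Gap M u w =
  (¬ ∃ λ i → On M i u) × (¬ ∃ λ i → On M i w) × Far u w ×
  ¬ ∃ λ X → Between u w X × X ≢ u × X ≢ w × ¬ ∃ λ i → On M i X

-- Such a column witnesses that S_i is not contained in S_j.
separates : Fin K → Fin K → Column K → Bool
separates i j c = is-just (lookup c i) ∧ not (is-just (lookup c j))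

-- The properties that a counterexample to the theorem would give its configuration.
record Bad {K n} (M : Vec (Column K) n) : Set where
  field
    sperner  : ∀ i j → i ≢ j → ∃ λ p → T (separates i j (lookup M p))
    noCorner : ∀ i v → ¬ SimpleCorner M i v
    noGap    : ∀ u w → ¬ Gap M u w

-- The case search on columns

bump : ℕ → Bool → Column K → Vec ℕ K → Vec ℕ K
bump k b = zipWith λ t s → if fits t b then s else k + s

-- The score of j is 2 as soon as the vertex under construction is at distance
-- at least 2 from Q_j or differs from Q_j in a coordinate that is free in Q_i.
corner : Fin K → Vec (Column K) m → Vec ℕ K → Bool
corner i []      sc = ⌊ all? (λ j → (j ≟ i) ⊎-dec (2 ≤? lookup sc j)) ⌋
corner i (c ∷ L) sc with lookup c i
... | just a  = corner i L (bump 1 a c sc)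
... | nothing = corner i L (bump 2 false c sc) ∨ corner i L (bump 2 true c sc)

on? : (M : Vec (Column K) n) (X : Subset n) → Dec (∃ λ i → On M i X)
on? M X = any? λ i → all? λ p → T? _

gap? : (M : Vec (Column K) n) → Dec (∃ λ u → ∃ λ w → Gap M u w)
gap? M = anySubset? λ u → anySubset? λ w →
  ¬? (on? M u) ×-dec ¬? (on? M w) ×-dec
  (any? λ p → any? λ q →
    ¬? (p ≟ q) ×-dec ¬? (lookup u p Bool.≟ lookup w p) ×-dec ¬? (lookup u q Bool.≟ lookup w q)) ×-dec
  ¬? (anySubset? λ X →
    (all? λ p → (lookup X p Bool.≟ lookup u p) ⊎-dec (lookup X p Bool.≟ lookup w p)) ×-dec
    ¬? (≡-dec Bool._≟_ X u) ×-dec ¬? (≡-dec Bool._≟_ X w) ×-dec ¬? (on? M X))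

unseparated? : (L : Vec (Column K) m) →
  Dec (∃ λ i → ∃ λ j → i ≢ j × ¬ ∃ λ k → T (separates i j (lookup L k)))
unseparated? L = any? λ i → any? λ j → ¬? (i ≟ j) ×-dec ¬? (any? λ k → T? _)

hasTrue : Column K → Bool
hasTrue c = ⌊ any? (λ i → ¬? (T? (fits (lookup c i) false))) ⌋

-- search f L A refutes every bad configuration that contains the columns L and
-- whose other columns all lie in A. If L has no simple corner, it adds a column
-- separating some S_i from S_j; when all pairs are separated it adds columns
-- containing true; when none is left, the other coordinates can be set to false
-- and a gap of L is a gap of the configuration. The first argument is fuel.
search : ℕ → Vec (Column K) m → List (Column K) → Bool
split  : ℕ → (L : Vec (Column K) m) → List (Column K) →
  Dec (∃ λ i → ∃ λ j → i ≢ j × ¬ ∃ λ k → T (separates i j (lookup L k))) → Bool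
branch : ℕ → (Column K → Bool) → Vec (Column K) m → List (Column K) → Bool
loop   : ℕ → List (Column K) → List (Column K) → Vec (Column K) m → Bool

search zero       L A = false
search {K} (suc f) L A =
  ⌊ any? (λ i → T? (corner i L (replicate K 0))) ⌋ ∨ split f L A (unseparated? L)

split f L A (yes (i , j , _)) = branch f (separates i j) L A
split f L A (no _)            = branch f hasTrue L A ∧ ⌊ gap? L ⌋

branch f φ L A = loop f (filter (T? ∘ φ) A) (filter (¬? ∘ T? ∘ φ) A) L

loop f []       o L = true
-- Columns may repeat, so `c` stays allowed below its own branch. Once that branch is refuted, no
-- remaining coordinate has column `c`, and the later branches drop it.
loop f (c ∷ cs) o L = search f (c ∷ L) ((c ∷ cs) ++ o) ∧ loop f cs o L

columns : ∀ K → List (Column K)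
columns zero    = [] ∷ []
columns (suc K) =
  List.map (nothing ∷_) (columns K) ++
  List.map (just false ∷_) (columns K) ++ List.map (just true ∷_) (columns K)

-- Complementing a coordinate changes nothing, so the first entry of a column
-- that is not nothing may be taken to be just false.
normalColumns : ∀ K → List (Column K)
normalColumns zero    = [] ∷ []
normalColumns (suc K) =
  List.map (nothing ∷_) (normalColumns K) ++ List.map (just false ∷_) (columns K)

-- Checked by evaluation; for `K` equal to 4 there are 41 normal columns. Each added column costs
-- one unit of fuel, so 9 leaves room for eight columns.
search-succeeds : ∀ K → 1 ≤ K → K ≤ 4 → search {K} 9 [] (normalColumns K) ≡ true
search-succeeds 1 _ _ = refl
search-succeeds 2 _ _ = refl
search-succeeds 3 _ _ = refl
search-succeeds 4 _ _ = refl
search-succeeds (suc (suc (suc (suc (suc _))))) _ (s≤s (s≤s (s≤s (s≤s ()))))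

-- Soundness of the corner test

Fresh : Fin n → Vec (Fin n) m → Set
Fresh p ps = ∀ k → p ≢ lookup ps k

Distinct : Vec (Fin n) m → Set
Distinct ps = ∀ k l → lookup ps k ≡ lookup ps l → k ≡ l

module _ {p : Fin n} {ps : Vec (Fin n) m} where

  head-fresh : Distinct (p ∷ ps) → Fresh p ps
  head-fresh d k eq with () ← d zero (suc k) eq

  tail-distinct : Distinct (p ∷ ps) → Distinct ps
  tail-distinct d k l eq with refl ← d (suc k) (suc l) eq = refl

  distinct-∷ : Fresh p ps → Distinct ps → Distinct (p ∷ ps)
  distinct-∷ fr d zero    zero    eq = refl
  distinct-∷ fr d zero    (suc l) eq = contradiction eq (fr l)
  distinct-∷ fr d (suc k) zero    eq = contradiction (sym eq) (fr k)
  distinct-∷ fr d (suc k) (suc l) eq = cong suc (d k l eq)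

module _ (M : Vec (Column K) n) (i : Fin K) where

  -- What a score certifies while the coordinates `ps` are still to be processed: nothing, one clash
  -- with Q_j, or a clash that survives each flip along S_i. Clashes are recorded outside `ps` only,
  -- so later changes of `v` keep them.
  Safe : Vec (Fin n) m → Fin K → Subset n → ℕ → Set
  Safe ps j v 0             = ⊤
  Safe ps j v 1             = ∃ λ q → Fresh q ps × Clash M j v q
  Safe ps j v (suc (suc _)) = ∀ e → Fixed M i e → ∃ λ q → q ≢ e × Fresh q ps × Clash M j v q

  Safe-2 : ∀ {ps : Vec (Fin n) m} {j v s} → 2 ≤ s → Safe ps j v s → Safe ps j v 2
  Safe-2 (s≤s (s≤s _)) safe = safe

  Clash-resp : ∀ {v v′ : Subset n} {j q} → lookup v′ q ≡ lookup v q → Clash M j v q → Clash M j v′ q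
  Clash-resp {j = j} {q} eq = subst (λ b → ¬ T (fits (lookup (lookup M q) j) b)) (sym eq)

  module _ {ps : Vec (Fin n) m} {p : Fin n} {j : Fin K} {v : Subset n} where

    safe-update : ∀ {v′} → (∀ q → q ≢ p → lookup v′ q ≡ lookup v q) →
      ∀ s → Safe (p ∷ ps) j v s → Safe ps j v′ s
    safe-update same 0 _ = tt
    safe-update {v′} same 1 (q , fr , cl) =
      q , fr ∘ suc , Clash-resp {v = v} {v′} (same q (fr zero)) cl
    safe-update {v′} same (suc (suc s)) safe e fx with q , q≢e , fr , cl ← safe e fx =
      q , q≢e , fr ∘ suc , Clash-resp {v = v} {v′} (same q (fr zero)) cl

    -- Two clashes at different coordinates suffice: a flip at `p` leaves the earlier clash, any
    -- other flip leaves the one at `p`.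
    safe-suc : Fresh p ps → Clash M j v p → ∀ s → Safe (p ∷ ps) j v s → Safe ps j v (1 + s)
    safe-suc fr cl 0 _ = p , fr , cl
    safe-suc fr cl 1 (q , fr′ , cl′) e _ with p ≟ e
    ... | no p≢e   = p , p≢e , fr , cl
    ... | yes refl = q , fr′ zero , fr′ ∘ suc , cl′
    safe-suc fr cl (suc (suc s)) = safe-update {v} (λ _ _ → refl) (suc (suc s))

    -- No flip along S_i touches a coordinate that is free in Q_i, so this single clash is worth
    -- two.
    safe-free : Fresh p ps → Clash M j v p → ¬ Fixed M i p → ∀ s → Safe ps j v (2 + s)
    safe-free fr cl free s e fx = p , (λ { refl → free fx }) , fr , cl

  Safe-bump : ∀ {ps : Vec (Fin n) m} {v j} k b p sc → b ≡ lookup v p →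
    Safe ps j v (lookup sc j) →
    (Clash M j v p → Safe ps j v (k + lookup sc j)) →
    Safe ps j v (lookup (bump k b (lookup M p) sc) j)
  Safe-bump {v = v} {j} k b p sc refl safe safe′
    rewrite lookup-zipWith (λ t s → if fits t b then s else k + s) j (lookup M p) sc
    with fits (lookup (lookup M p) j) b
  ... | true  = safe
  ... | false = safe′ λ ()

  module FreeColumn {p : Fin n} {ps : Vec (Fin n) m} {v sc}
    (d : Distinct (p ∷ ps)) (on : On M i v)
    (safe : ∀ j → j ≢ i → Safe (p ∷ ps) j v (lookup sc j))
    (eq : lookup (lookup M p) i ≡ nothing) where

    on-update : ∀ b → On M i (v [ p ]≔ b)
    on-update b q with q ≟ p
    ... | yes refl = subst (λ t → T (fits t (lookup (v [ p ]≔ b) p))) (sym eq) tt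
    ... | no q≢p   = subst (λ x → T (fits (lookup (lookup M q) i) x))
                       (sym (lookup∘update′ q≢p v b)) (on q)

    safe-bump : ∀ b j → j ≢ i →
      Safe ps j (v [ p ]≔ b) (lookup (bump 2 b (lookup M p) sc) j)
    safe-bump b j j≢i = Safe-bump {v = v [ p ]≔ b} 2 b p sc (sym (lookup∘update p v b))
      (safe-update {v = v} {v [ p ]≔ b} (λ q q≢p → lookup∘update′ q≢p v b) (lookup sc j) (safe j j≢i))
      (λ cl → safe-free {ps = ps} {v = v [ p ]≔ b} (head-fresh d) cl
                (λ fx → subst (T ∘ is-just) eq fx) (lookup sc j))

  -- Throughout the recursion `v` lies in Q_i, because only coordinates free in Q_i are reassigned,
  -- and the scores remain certified by `Safe`. At the end, scores of at least 2 are the condition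
  -- on a simple corner.
  corner-sound : ∀ (ps : Vec (Fin n) m) → Distinct ps → ∀ sc v → On M i v →
    (∀ j → j ≢ i → Safe ps j v (lookup sc j)) →
    T (corner i (map (lookup M) ps) sc) → ∃ (SimpleCorner M i)
  corner-sound [] _ sc v on safe t = v , on , far
    where
    far : ∀ j → j ≢ i → ∀ e → Fixed M i e → ∃ λ p → p ≢ e × Clash M j v p
    far j j≢i e fx with toWitness t j
    ... | inj₁ j≡i = contradiction j≡i j≢i
    ... | inj₂ 2≤s = let p , p≢e , _ , cl = Safe-2 2≤s (safe j j≢i) e fx in p , p≢e , cl
  corner-sound (p ∷ ps) d sc v on safe t with lookup (lookup M p) i in eq
  ... | just a = corner-sound ps (tail-distinct d) _ v on safe′ t
    where
    a≡vp : a ≡ lookup v p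
    a≡vp = fits-just a _ (subst (λ t → T (fits t (lookup v p))) eq (on p))
    safe′ : ∀ j → j ≢ i → Safe ps j v (lookup (bump 1 a (lookup M p) sc) j)
    safe′ j j≢i = Safe-bump {v = v} 1 a p sc a≡vp
      (safe-update {v = v} {v} (λ _ _ → refl) (lookup sc j) (safe j j≢i))
      (λ cl → safe-suc {v = v} (head-fresh d) cl (lookup sc j) (safe j j≢i))
  ... | nothing with Equivalence.to T-∨ t
  ...   | inj₁ t₁ = corner-sound ps (tail-distinct d) _ _ (on-update false) (safe-bump false) t₁
    where open FreeColumn {sc = sc} d on safe eq
  ...   | inj₂ t₂ = corner-sound ps (tail-distinct d) _ _ (on-update true) (safe-bump true) t₂
    where open FreeColumn {sc = sc} d on safe eq

-- Extending assignments and gaps to all coordinates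

spreadAt : (ps : Vec (Fin n) m) → Subset m → Fin n → Bool
spreadAt ps x p with any? (λ k → p ≟ lookup ps k)
... | yes (k , _) = lookup x k
-- The default is the value that all remaining columns accept once those containing `just true` are
-- excluded.
... | no _        = false

spread : Vec (Fin n) m → Subset m → Subset n
spread ps x = tabulate (spreadAt ps x)

module _ {ps : Vec (Fin n) m} (d : Distinct ps) (x : Subset m) where

  spreadAt-lookup : ∀ k → spreadAt ps x (lookup ps k) ≡ lookup x k
  spreadAt-lookup k with any? (λ l → lookup ps k ≟ lookup ps l)
  ... | yes (l , eq) = cong (lookup x) (sym (d k l eq))
  ... | no ¬eq       = contradiction (k , refl) ¬eq

  spread-lookup : ∀ k → lookup (spread ps x) (lookup ps k) ≡ lookup x k
  spread-lookup k = trans (lookup∘tabulate _ (lookup ps k)) (spreadAt-lookup k)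

  spreadAt-fresh : ∀ {p} → Fresh p ps → spreadAt ps x p ≡ false
  spreadAt-fresh {p} fr with any? (λ l → p ≟ lookup ps l)
  ... | yes (l , eq) = contradiction eq (fr l)
  ... | no _         = refl

  spread-fresh : ∀ {p} → Fresh p ps → lookup (spread ps x) p ≡ false
  spread-fresh {p} fr = trans (lookup∘tabulate _ p) (spreadAt-fresh fr)

occurs? : (p : Fin n) (ps : Vec (Fin n) m) → Fresh p ps ⊎ ∃ λ k → p ≡ lookup ps k
occurs? p ps with any? (λ k → p ≟ lookup ps k)
... | yes (k , eq) = inj₂ (k , eq)
... | no ¬eq       = inj₁ λ k eq → ¬eq (k , eq)

module _ {M : Vec (Column K) n} {ps : Vec (Fin n) m} (d : Distinct ps) where

  on-restrict : ∀ {i X} → On M i X → On (map (lookup M) ps) i (map (lookup X) ps)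
  on-restrict {i} {X} on k
    rewrite lookup-map k (lookup M) ps | lookup-map k (lookup X) ps = on (lookup ps k)

  map-spread : ∀ x → map (lookup (spread ps x)) ps ≡ x
  map-spread x = lookup-ext λ k → trans (lookup-map k _ ps) (spread-lookup d x k)

  module _ (compatible : ∀ p → Fresh p ps → ∀ i → T (fits (lookup (lookup M p) i) false)) where

    on-extend : ∀ {i X} → (∀ p → Fresh p ps → lookup X p ≡ false) →
      On (map (lookup M) ps) i (map (lookup X) ps) → On M i X
    on-extend {i} {X} zero-off on p with occurs? p ps
    ... | inj₁ fr rewrite zero-off p fr = compatible p fr i
    ... | inj₂ (k , refl) = subst₂ (λ c b → T (fits (lookup c i) b))
            (lookup-map k (lookup M) ps) (lookup-map k (lookup X) ps) (on k)

    -- Everything between the two extensions is false outside `ps`. Restriction to `ps` thus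
    -- identifies the spanned subcubes, and by `compatible` it preserves membership in each Q_i.
    gap-extend : ∀ {u w} → Gap (map (lookup M) ps) u w → Gap M (spread ps u) (spread ps w)
    gap-extend {u} {w} (u∉ , w∉ , (p , q , p≢q , up≢wp , uq≢wq) , between) =
      off u∉ , off w∉ ,
      (lookup ps p , lookup ps q , (λ eq → p≢q (d p q eq)) , differ up≢wp , differ uq≢wq) ,
      λ (X , btw , X≢u , X≢w , X∉) → between
        ( map (lookup X) ps
        , (λ k → subst₂ (λ a b → a ≡ lookup u k ⊎ a ≡ b) (sym (lookup-map k (lookup X) ps)) refl
                   (subst₂ (λ a b → lookup X (lookup ps k) ≡ a ⊎ lookup X (lookup ps k) ≡ b)
                      (spread-lookup d u k) (spread-lookup d w k) (btw (lookup ps k))))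
        , (λ eq → X≢u (unspread {X} btw eq (λ p fr → sym (spread-fresh d u fr))))
        , (λ eq → X≢w (unspread {X} btw eq (λ p fr → sym (spread-fresh d w fr))))
        , (λ (i , on) → X∉ (i , on-extend {i} {X} (zero-off {X} btw) on)))
      where
      off : ∀ {x} → ¬ (∃ λ i → On (map (lookup M) ps) i x) → ¬ ∃ λ i → On M i (spread ps x)
      off {x} x∉ (i , on) =
        x∉ (i , subst (On (map (lookup M) ps) i) (map-spread x) (on-restrict {i} {spread ps x} on))
      differ : ∀ {k} → lookup u k ≢ lookup w k →
        lookup (spread ps u) (lookup ps k) ≢ lookup (spread ps w) (lookup ps k)
      differ {k} = subst₂ _≢_ (sym (spread-lookup d u k)) (sym (spread-lookup d w k))
      zero-off : ∀ {X} → Between (spread ps u) (spread ps w) X → ∀ p → Fresh p ps → lookup X p ≡ false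
      zero-off btw p fr with btw p
      ... | inj₁ eq = trans eq (spread-fresh d u fr)
      ... | inj₂ eq = trans eq (spread-fresh d w fr)
      unspread : ∀ {X x} → Between (spread ps u) (spread ps w) X → map (lookup X) ps ≡ x →
        (∀ p → Fresh p ps → false ≡ lookup (spread ps x) p) → X ≡ spread ps x
      unspread {X} {x} btw refl fr≡ = lookup-ext agree
        where
        agree : ∀ p → lookup X p ≡ lookup (spread ps (map (lookup X) ps)) p
        agree p with occurs? p ps
        ... | inj₁ fr = trans (zero-off {X} btw p fr) (fr≡ p fr)
        ... | inj₂ (k , refl) =
              sym (trans (spread-lookup d (map (lookup X) ps) k) (lookup-map k (lookup X) ps))

-- Soundness of the search

module _ {M : Vec (Column K) n} (bad : Bad M) where
  open Bad bad

  -- The chosen columns sit at the distinct coordinates `ps`, and all other coordinates have columns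
  -- in `A`. Induction on the fuel, mutual with `loop-sound`.
  search-sound : ∀ f (ps : Vec (Fin n) m) → Distinct ps → ∀ A →
    (∀ p → Fresh p ps → lookup M p ∈ A) → ¬ T (search f (map (lookup M) ps) A)
  loop-sound : ∀ f (ps : Vec (Fin n) m) → Distinct ps → ∀ cs o →
    (∀ p → Fresh p ps → lookup M p ∈ cs ++ o) → T (loop f cs o (map (lookup M) ps)) →
    ∀ p → Fresh p ps → lookup M p ∈ o

  -- Every candidate satisfying `φ` has been refuted as a further column, so a fresh coordinate can
  -- only have a column that fails `φ`.
  branch-sound : ∀ f (φ : Column K → Bool) (ps : Vec (Fin n) m) → Distinct ps → ∀ A →
    (∀ p → Fresh p ps → lookup M p ∈ A) → T (branch f φ (map (lookup M) ps) A) →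
    ∀ p → Fresh p ps → ¬ T (φ (lookup M p))
  branch-sound f φ ps d A allowed t p fr =
    proj₂ (∈-filter⁻ (¬? ∘ T? ∘ φ) {xs = A} (loop-sound f ps d _ _ sorted t p fr))
    where
    sorted : ∀ p → Fresh p ps → lookup M p ∈ filter (T? ∘ φ) A ++ filter (¬? ∘ T? ∘ φ) A
    sorted p fr with T? (φ (lookup M p))
    ... | yes y = ∈-++⁺ˡ (∈-filter⁺ (T? ∘ φ) (allowed p fr) y)
    ... | no ¬y = ∈-++⁺ʳ _ (∈-filter⁺ (¬? ∘ T? ∘ φ) (allowed p fr) ¬y)

  loop-sound f ps d []       o allowed t p fr = allowed p fr
  loop-sound f ps d (c ∷ cs) o allowed t
    with t₁ , t₂ ← Equivalence.to T-∧ t = loop-sound f ps d cs o allowed′ t₂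
    where
    allowed′ : ∀ p → Fresh p ps → lookup M p ∈ cs ++ o
    allowed′ p fr with allowed p fr
    ... | there c∈ = c∈
    -- A fresh coordinate with column `c` could be prepended to `ps`, where the search has
    -- succeeded.
    ... | here refl = ⊥-elim (search-sound f (p ∷ ps) (distinct-∷ fr d) (lookup M p ∷ cs ++ o)
                        (λ q fr → allowed q (fr ∘ suc)) t₁)

  search-sound (suc f) ps d A allowed t with Equivalence.to T-∨ t
  ... | inj₁ t₁ =
        let i , c = toWitness {a? = any? λ i → T? (corner i (map (lookup M) ps) (replicate K 0))} t₁
            v , simple = corner-sound M i ps d (replicate _ 0) (tabulate λ p → default i p)
              (λ p → on-default i p) (λ j _ → subst (Safe M i ps j _) (sym (lookup-replicate j 0)) tt) c
        in noCorner i v simple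
    where
    -- The initial vertex of Q_i; its free coordinates are false until the corner test reassigns
    -- those in `ps`.
    default : Fin K → Fin n → Bool
    default i p = fromMaybe false (lookup (lookup M p) i)
    on-default : ∀ i → On M i (tabulate (default i))
    on-default i p rewrite lookup∘tabulate (default i) p with lookup (lookup M p) i
    ... | nothing    = tt
    ... | just false = tt
    ... | just true  = tt
  ... | inj₂ t₂ with unseparated? (map (lookup M) ps)
  -- The Sperner property provides a separating coordinate. If fresh, it was refuted by the
  -- branching; if in `ps`, the pair would already be separated.
  ...   | yes (i , j , i≢j , none) with p , sep ← sperner i j i≢j | occurs? p ps
  ...     | inj₁ fr = branch-sound f (separates i j) ps d A allowed t₂ p fr sep
  ...     | inj₂ (k , refl) =
            none (k , subst (T ∘ separates i j) (sym (lookup-map k (lookup M) ps)) sep)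
  search-sound (suc f) ps d A allowed t | inj₂ t₂ | no _
    with t₃ , t₄ ← Equivalence.to T-∧ t₂ with u , w , gap ← toWitness {a? = gap? (map (lookup M) ps)} t₄ =
    noGap _ _ (gap-extend {M = M} {ps} d compatible gap)
    where
    compatible : ∀ p → Fresh p ps → ∀ i → T (fits (lookup (lookup M p) i) false)
    compatible p fr i = decidable-stable (T? _) λ ¬fits →
      -- An entry that rejects false makes the column one of those excluded by the second branching.
      branch-sound f hasTrue ps d A allowed t₃ p fr (fromWitness (i , ¬fits))

bad-impossible : ∀ K → 1 ≤ K → K ≤ 4 → (M : Vec (Column K) n) →
  (∀ p → lookup M p ∈ normalColumns K) → ¬ Bad M
bad-impossible K 1≤K K≤4 M normal bad =
  search-sound bad 9 [] (λ ()) _ (λ p _ → normal p) (Equivalence.from T-≡ (search-succeeds K 1≤K K≤4))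

-- The configuration of a family 𝓕(𝒮,h)

∈-columns : (c : Column K) → c ∈ columns K
∈-columns []               = here refl
∈-columns (nothing ∷ c)    = ∈-++⁺ˡ (∈-map⁺ (nothing ∷_) (∈-columns c))
∈-columns {suc K} (just false ∷ c) = ∈-++⁺ʳ (List.map (nothing ∷_) (columns K))
  (∈-++⁺ˡ (∈-map⁺ (just false ∷_) (∈-columns c)))
∈-columns {suc K} (just true ∷ c)  = ∈-++⁺ʳ (List.map (nothing ∷_) (columns K))
  (∈-++⁺ʳ (List.map (just false ∷_) (columns K)) (∈-map⁺ (just true ∷_) (∈-columns c)))

-- The first entry other than `nothing` is the mask: xor with itself makes it false.
normalise : (c : Column K) → ∃ λ s → map (Maybe.map (s xor_)) c ∈ normalColumns K
normalise []            = false , here refl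
normalise (nothing ∷ c) = let s , c∈ = normalise c in s , ∈-++⁺ˡ (∈-map⁺ (nothing ∷_) c∈)
normalise {suc K} (just b ∷ c) = b , ∈-++⁺ʳ (List.map (nothing ∷_) (normalColumns K))
  (subst (λ x → just x ∷ c′ ∈ List.map (just false ∷_) (columns K)) (sym (xor-same b))
    (∈-map⁺ (just false ∷_) (∈-columns c′)))
  where
  c′ : Column K
  c′ = map (Maybe.map (b xor_)) c

entry : Bool → Bool → Maybe Bool
entry s b = if s then just b else nothing

-- Complementing an entry amounts to complementing the coordinate of the vertex, which is how
-- normalised columns are read back.
fits-twist⁻ : ∀ t s b x → T (fits (Maybe.map (t xor_) (entry s b)) x) → s ≡ true → t xor x ≡ b
fits-twist⁻ false true b x fx refl = sym (fits-just b x fx)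
fits-twist⁻ true  true b x fx refl = trans (cong not (sym (fits-just (not b) x fx))) (not-involutive b)

fits-twist⁺ : ∀ t s b x → (s ≡ true → t xor x ≡ b) → T (fits (Maybe.map (t xor_) (entry s b)) x)
fits-twist⁺ t     false b     x     _  = tt
fits-twist⁺ false true  b     x     eq with refl ← eq refl = Equivalence.from T-not-≡ (xor-same x)
fits-twist⁺ true  true  b     x     eq with refl ← eq refl
  rewrite not-involutive x = Equivalence.from T-not-≡ (xor-same x)

-- Makes different indices in `members` denote different sets, as needed to apply the antichain
-- hypothesis.
allSubsets-unique : ∀ n → Unique (allSubsets n)
allSubsets-unique zero    = All.[] AllPairs.∷ AllPairs.[]
allSubsets-unique (suc n) = Unique.++⁺
  (Unique.map⁺ ∷-injectiveʳ (allSubsets-unique n))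
  (Unique.map⁺ ∷-injectiveʳ (allSubsets-unique n))
  λ (out , in′) → disjoint (∈-map⁻ _ out) (∈-map⁻ _ in′)
  where
  disjoint : ∀ {X : Subset (suc n)} →
    (∃ λ Y → Y ∈ allSubsets n × X ≡ outside ∷ Y) → ¬ ∃ λ Y → Y ∈ allSubsets n × X ≡ inside ∷ Y
  disjoint (_ , _ , refl) (_ , _ , ())

lookup-injective : ∀ {A : Set} {xs : List A} → Unique xs →
  ∀ i j → List.lookup xs i ≡ List.lookup xs j → i ≡ j
lookup-injective (x∉ AllPairs.∷ u) zero    zero    eq = refl
lookup-injective (x∉ AllPairs.∷ u) zero    (suc j) eq = contradiction eq (All.lookup x∉ (∈-lookup j))
lookup-injective (x∉ AllPairs.∷ u) (suc i) zero    eq = contradiction (sym eq) (All.lookup x∉ (∈-lookup i))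
lookup-injective (x∉ AllPairs.∷ u) (suc i) (suc j) eq = cong suc (lookup-injective u i j eq)

members : Family n → List (Subset n)
members {n} 𝒮 = filter (λ S → 𝒮 S Bool.≟ true) (allSubsets n)

length-members : (𝒮 : Family n) → List.length (members 𝒮) ≡ card 𝒮
length-members {n} 𝒮 = go (allSubsets n)
  where
  go : ∀ Ss → List.length (filter (λ S → 𝒮 S Bool.≟ true) Ss) ≡
    sum (List.map (λ S → if 𝒮 S then 1 else 0) Ss)
  go []       = refl
  go (S ∷ Ss) with 𝒮 S
  ... | true  = cong suc (go Ss)
  ... | false = go Ss

module _ (𝒮 : Family n) (h : Subset n → Subset n)
  (antichain : (A B : Subset n) → 𝒮 A ≡ true → 𝒮 B ≡ true → A ⊆ B → A ≡ B)
  (h⊆ : (S : Subset n) → 𝒮 S ≡ true → h S ⊆ S)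
  (ext : SExtremal (FSh 𝒮 h)) where

  private
    F : Family n
    F = FSh 𝒮 h
    k : ℕ
    k = List.length (members 𝒮)

  member : Fin k → Subset n
  member = List.lookup (members 𝒮)

  member-𝒮 : ∀ i → 𝒮 (member i) ≡ true
  member-𝒮 i = proj₂ (∈-filter⁻ (λ S → 𝒮 S Bool.≟ true) {xs = allSubsets n} (∈-lookup i))

  member-surjective : ∀ {S} → 𝒮 S ≡ true → ∃ λ i → S ≡ member i
  member-surjective {S} 𝒮S = index S∈ , lookup-index S∈
    where
    S∈ : S ∈ members 𝒮
    S∈ = ∈-filter⁺ (λ S → 𝒮 S Bool.≟ true) (∈-allSubsets S) 𝒮S

  rawColumn : Fin n → Column k
  rawColumn p = tabulate λ i → entry (lookup (member i) p) (lookup (h (member i)) p)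

  flip : Fin n → Bool
  flip p = proj₁ (normalise (rawColumn p))

  config : Vec (Column k) n
  config = tabulate λ p → map (Maybe.map (flip p xor_)) (rawColumn p)

  config-normal : ∀ p → lookup config p ∈ normalColumns k
  config-normal p = subst (_∈ normalColumns k) (sym (lookup∘tabulate _ p)) (proj₂ (normalise (rawColumn p)))

  config-entry : ∀ p i → lookup (lookup config p) i ≡
    Maybe.map (flip p xor_) (entry (lookup (member i) p) (lookup (h (member i)) p))
  config-entry p i = trans (cong (λ c → lookup c i) (lookup∘tabulate _ p))
    (trans (lookup-map i _ (rawColumn p)) (cong (Maybe.map (flip p xor_)) (lookup∘tabulate _ i)))

  -- The automorphism of the cube that undoes the normalisation: it carries the subcubes of `config`
  -- to the sets Q_{S,h(S)}.
  twist : Subset n → Subset n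
  twist X = tabulate λ p → flip p xor lookup X p

  lookup-twist : ∀ X p → lookup (twist X) p ≡ flip p xor lookup X p
  lookup-twist X p = lookup∘tabulate _ p

  twist-involutive : ∀ X → twist (twist X) ≡ X
  twist-involutive X = lookup-ext λ p → begin
    lookup (twist (twist X)) p          ≡⟨ lookup-twist (twist X) p ⟩
    flip p xor lookup (twist X) p       ≡⟨ cong (flip p xor_) (lookup-twist X p) ⟩
    flip p xor (flip p xor lookup X p)  ≡⟨ xor-assoc (flip p) (flip p) (lookup X p) ⟨
    (flip p xor flip p) xor lookup X p  ≡⟨ cong (_xor lookup X p) (xor-same (flip p)) ⟩
    lookup X p                          ∎
    where open ≡-Reasoning

  twist-≡ : ∀ {X Y p} → lookup X p ≡ lookup Y p → lookup (twist X) p ≡ lookup (twist Y) p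
  twist-≡ {X} {Y} {p} eq =
    trans (lookup-twist X p) (trans (cong (flip p xor_) eq) (sym (lookup-twist Y p)))

  twist-≡⁻ : ∀ {X Y p} → lookup (twist X) p ≡ lookup (twist Y) p → lookup X p ≡ lookup Y p
  twist-≡⁻ {X} {Y} {p} eq = subst₂ (λ A B → lookup A p ≡ lookup B p)
    (twist-involutive X) (twist-involutive Y) (twist-≡ {twist X} {twist Y} eq)

  fits-entry⁺ : ∀ {i X p} →
    (lookup (member i) p ≡ true → lookup (twist X) p ≡ lookup (h (member i)) p) →
    T (fits (lookup (lookup config p) i) (lookup X p))
  fits-entry⁺ {i} {X} {p} agree rewrite config-entry p i =
    fits-twist⁺ (flip p) _ _ _ λ Sp → trans (sym (lookup-twist X p)) (agree Sp)

  On⇒Agree : ∀ {i X} → On config i X → Agree (member i) (twist X) (h (member i))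
  On⇒Agree {i} {X} on p Sp = trans (lookup-twist X p)
    (fits-twist⁻ (flip p) _ _ _ (subst (λ t → T (fits t (lookup X p))) (config-entry p i) (on p)) Sp)

  On⇒∉ : ∀ {i X} → On config i X → F (twist X) ≡ false
  On⇒∉ {i} {X} on = FSh-false-intro 𝒮 h h⊆ (member-𝒮 i) (On⇒Agree {i} {X} on)

  ∉⇒On : ∀ {X} → F (twist X) ≡ false → ∃ λ i → On config i X
  ∉⇒On {X} ∉ with S , 𝒮S , agree ← FSh-false-elim 𝒮 h ∉ with i , refl ← member-surjective 𝒮S =
    i , λ p → fits-entry⁺ {i} {X} (agree p)

  ∉On⇒∈ : ∀ {X} → ¬ (∃ λ i → On config i X) → F (twist X) ≡ true
  ∉On⇒∈ {X} off with F (twist X) in eq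
  ... | true  = refl
  ... | false = contradiction (∉⇒On {X} eq) off

  member-fixed : ∀ {i e} → lookup (member i) e ≡ true → Fixed config i e
  member-fixed {i} {e} Se rewrite config-entry e i | Se = tt

  config-sperner : ∀ i j → i ≢ j → ∃ λ p → T (separates i j (lookup config p))
  config-sperner i j i≢j
    with any? (λ p → (lookup (member i) p Bool.≟ true) ×-dec (lookup (member j) p Bool.≟ false))
  ... | yes (p , Sp , ¬Sp) = p , separated
    where
    separated : T (separates i j (lookup config p))
    separated rewrite config-entry p i | config-entry p j | Sp | ¬Sp = tt
  -- Without a separating coordinate S_i is contained in S_j, hence equal to it.
  ... | no none = contradiction (lookup-injective members-unique i j
          (antichain _ _ (member-𝒮 i) (member-𝒮 j) (lookup⇒⊆ sub))) i≢j
    where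
    members-unique : Unique (members 𝒮)
    members-unique = Unique.filter⁺ (λ S → 𝒮 S Bool.≟ true) (allSubsets-unique n)
    sub : ∀ p → lookup (member i) p ≡ true → lookup (member j) p ≡ true
    sub p Sp with lookup (member j) p in eq
    ... | true  = refl
    ... | false = contradiction (p , Sp , eq) none

  corner-extends : ∀ i v → SimpleCorner config i v → ∃ λ X → F X ≡ false × SExtremal (addSet F X)
  corner-extends i v (on , far) =
    twist v , On⇒∉ {i} {v} on , SExtremal-addSet F (member i) (twist v) subcube edges ext
    where
    subcube : ∀ X → Agree (member i) X (twist v) → F X ≡ false
    subcube X agree = FSh-false-intro 𝒮 h h⊆ (member-𝒮 i)
      λ p Sp → trans (agree p Sp) (On⇒Agree {i} {v} on p Sp)
    edges : ∀ e → lookup (member i) e ≡ true → F (toggle e (twist v)) ≡ true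
    edges e Se with F (toggle e (twist v)) in eq
    ... | true  = refl
    ... | false with S , 𝒮S , agree ← FSh-false-elim 𝒮 h eq with j , refl ← member-surjective 𝒮S
                with j ≟ i
    -- Flipping a coordinate of S_i leaves Q_i itself; every other Q_j is avoided by a clash away
    -- from `e`.
    ...   | yes refl = contradiction
              (trans (On⇒Agree {i} {v} on e Se) (trans (sym (agree e Se)) (lookup-toggle e (twist v))))
              (not-¬ refl)
    ...   | no j≢i with p , p≢e , clash ← far j j≢i e (member-fixed {i} Se) =
              contradiction (fits-entry⁺ {j} {v} λ Sp → trans (sym (lookup-toggle-≢ p≢e (twist v))) (agree p Sp)) clash

  -- `twist` acts on each coordinate separately, so it preserves betweenness and differing
  -- coordinates and carries the gap to one of `F`.
  config-noGap : ∀ u w → ¬ Gap config u w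
  config-noGap u w (u∉ , w∉ , (p , q , p≢q , up≢wp , uq≢wq) , none) =
    SExtremal-no-gap F ext (twist u) (twist w) (∉On⇒∈ {u} u∉) (∉On⇒∈ {w} w∉) p≢q
      (up≢wp ∘ twist-≡⁻ {u} {w}) (uq≢wq ∘ twist-≡⁻ {u} {w})
      λ X FX between → ends X FX between
        (≡-dec Bool._≟_ (twist X) u) (≡-dec Bool._≟_ (twist X) w)
    where
    untwist : ∀ {X Y} → twist X ≡ Y → X ≡ twist Y
    untwist {X} eq = trans (sym (twist-involutive X)) (cong twist eq)
    ends : ∀ X → F X ≡ true → Between (twist u) (twist w) X →
      Dec (twist X ≡ u) → Dec (twist X ≡ w) → X ≡ twist u ⊎ X ≡ twist w
    ends X FX between (yes eq) _        = inj₁ (untwist eq)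
    ends X FX between (no _)   (yes eq) = inj₂ (untwist eq)
    ends X FX between (no ≢u)  (no ≢w)  = contradiction (twist X , between′ , ≢u , ≢w , off) none
      where
      between′ : Between u w (twist X)
      between′ p with between p
      ... | inj₁ eq = inj₁ (trans (twist-≡ {X} {twist u} eq) (cong (λ Y → lookup Y p) (twist-involutive u)))
      ... | inj₂ eq = inj₂ (trans (twist-≡ {X} {twist w} eq) (cong (λ Y → lookup Y p) (twist-involutive w)))
      off : ¬ ∃ λ i → On config i (twist X)
      off (i , on) with () ← trans (sym FX)
        (trans (cong F (sym (twist-involutive X))) (On⇒∉ {i} {twist X} on))

-- Existence of the extension

sExtremal? : (F : Family n) → Dec (SExtremal F)
sExtremal? F = card (Sh F) Nat.≟ card F

theorem10 : (n : ℕ) (𝒮 : Family n) (h : Subset n → Subset n) →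
    Σ (Subset n) (λ S → 𝒮 S ≡ true) →
    ((A B : Subset n) → 𝒮 A ≡ true → 𝒮 B ≡ true → A ⊆ B → A ≡ B) →
    card 𝒮 ≤ 4 →
    ((S : Subset n) → 𝒮 S ≡ true → h S ⊆ S) →
    SExtremal (FSh 𝒮 h) →
    Σ (Subset n) (λ F → (FSh 𝒮 h F ≡ false) × SExtremal (addSet (FSh 𝒮 h) F))
theorem10 n 𝒮 h (S , 𝒮S) antichain card≤4 h⊆ ext =
  -- The search for the new set is finite and decidable, which permits an argument by contradiction:
  -- if no set extends the family, there is no simple corner.
  decidable-stable (anySubset? λ X → (FSh 𝒮 h X Bool.≟ false) ×-dec sExtremal? (addSet (FSh 𝒮 h) X)) λ none →
    bad-impossible _ nonempty (subst (_≤ 4) (sym (length-members 𝒮)) card≤4)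
      (config 𝒮 h antichain h⊆ ext) (config-normal 𝒮 h antichain h⊆ ext)
      record
        { sperner  = config-sperner 𝒮 h antichain h⊆ ext
        ; noCorner = λ i v corner → none (corner-extends 𝒮 h antichain h⊆ ext i v corner)
        ; noGap    = config-noGap 𝒮 h antichain h⊆ ext
        }
  where
  nonempty : 1 ≤ List.length (members 𝒮)
  nonempty = Fin⇒1≤ (proj₁ (member-surjective 𝒮 h antichain h⊆ ext 𝒮S))
    where
    Fin⇒1≤ : ∀ {k} → Fin k → 1 ≤ k
    Fin⇒1≤ {suc _} _ = s≤s z≤n
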